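{- Let $h\ge 2$, let $T_h$ be the complete binary tree of height $h$, and let $\ell$ be a leaf of $T_h$ (a vertex at distance $h$ from the root). Let $T_h-\ell$ denote the tree obtained by deleting $\ell$. Then $$\gamma(T_h-\ell)=\gamma(T_h),\qquad \zeta(T_h-\ell)=2\,\zeta(T_h).$$
   Context: The complete binary tree $T_h$ of height $h$ is the rooted tree in which every vertex at distance less than $h$ from the root has exactly two children and the vertices at distance $h$ from the root are leaves. It is regarded as a finite simple (undirected) graph. For a finite simple graph $G$, a set $D\subseteq V(G)$ is dominating if every vertex of $G$ lies in $D$ or has a neighbor in $D$. The domination number $\gamma(G)$ is the minimum size of a dominating set. The dominion $\zeta(G)$ is the number of dominating sets of $G$ of size $\gamma(G)$. -}

module Defs where

open import Data.Fin.Base using (Fin; zero; suc; punchIn; splitAt; join)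
open import Data.Fin.Properties using (all?; any?; splitAt-join; join-splitAt)
open import Data.Fin.Subset using (Subset; _∈_; ∣_∣; inside; outside)
open import Data.Fin.Subset.Properties using (_∈?_)
open import Data.List.Base using (List; []; _∷_; [_]; _++_; map; filter; length)
open import Data.List.Extrema.Nat using (min)
open import Data.Nat.Base using (ℕ; zero; suc; _+_; _≤_)
open import Data.Nat.Properties using () renaming (_≟_ to _≟ℕ_)
open import Data.Product.Base using (∃; _×_; _,_)
open import Data.Sum.Base using (_⊎_; inj₁; inj₂; swap)
open import Data.Vec.Base using ([]; _∷_)
open import Function.Bundles using (_↔_; mk↔ₛ′; Inverse)
open import Relation.Binary.Definitions using (Decidable; Symmetric)
open import Relation.Binary.PropositionalEquality
  using (_≡_; refl; cong; trans)
open import Relation.Nullary using (¬_; yes; no)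
open import Relation.Nullary.Decidable using (_×-dec_; _⊎-dec_; map′)
open import Relation.Unary using () renaming (Decidable to Decidable₁)

record Graph (n : ℕ) : Set₁ where
  field
    Adj        : Fin n → Fin n → Set
    adj?       : Decidable Adj
    adj-sym    : Symmetric Adj
    adj-irrefl : ∀ {v} → ¬ Adj v v

open Graph public

-- punchIn v enumerates the vertices other than v, so this is the
-- subgraph induced on the complement of v.
delete : ∀ {n} → Graph (suc n) → Fin (suc n) → Graph n
delete G v = record
  { Adj        = λ i j → Adj G (punchIn v i) (punchIn v j)
  ; adj?       = λ i j → adj? G (punchIn v i) (punchIn v j)
  ; adj-sym    = adj-sym G
  ; adj-irrefl = adj-irrefl G
  }

data Walk {n : ℕ} (G : Graph n) : Fin n → Fin n → ℕ → Set where
  stop : ∀ {v} → Walk G v v zero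
  step : ∀ {u v w k} → Adj G u v → Walk G v w k → Walk G u w (suc k)

IsDistance : ∀ {n} → Graph n → Fin n → Fin n → ℕ → Set
IsDistance G u v d = Walk G u v d × (∀ {k} → Walk G u v k → d ≤ k)

Dominating : ∀ {n} → Graph n → Subset n → Set
Dominating G D = ∀ v → v ∈ D ⊎ ∃ λ u → Adj G v u × u ∈ D

dominating? : ∀ {n} (G : Graph n) → Decidable₁ (Dominating G)
dominating? G D =
  all? λ v → (v ∈? D) ⊎-dec any? λ u → adj? G v u ×-dec (u ∈? D)

subsets : ∀ n → List (Subset n)
subsets zero    = [ [] ]
subsets (suc n) = map (outside ∷_) (subsets n) ++ map (inside ∷_) (subsets n)

dominatingSets : ∀ {n} → Graph n → List (Subset n)
dominatingSets {n} G = filter (dominating? G) (subsets n)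

-- The default value n is harmless: the whole vertex set is dominating
-- and has size n.
γ : ∀ {n} → Graph n → ℕ
γ {n} G = min n (map ∣_∣ (dominatingSets G))

ζ : ∀ {n} → Graph n → ℕ
ζ G = length (filter (λ D → ∣ D ∣ ≟ℕ γ G) (dominatingSets G))

-- A vertex is the path leading to it from the root.
data Vertex : ℕ → Set where
  root  : ∀ {h} → Vertex h
  left  : ∀ {h} → Vertex h → Vertex (suc h)
  right : ∀ {h} → Vertex h → Vertex (suc h)

-- Child u v : v is a child of u.
data Child : ∀ {h} → Vertex h → Vertex h → Set where
  root-left  : ∀ {h} → Child {suc h} root (left root)
  root-right : ∀ {h} → Child {suc h} root (right root)
  left       : ∀ {h} {u v : Vertex h} → Child u v → Child (left u) (left v)
  right      : ∀ {h} {u v : Vertex h} → Child u v → Child (right u) (right v)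

child? : ∀ {h} → Decidable (Child {h})
child? root      root              = no λ ()
child? root      (left root)       = yes root-left
child? root      (left (left _))   = no λ ()
child? root      (left (right _))  = no λ ()
child? root      (right root)      = yes root-right
child? root      (right (left _))  = no λ ()
child? root      (right (right _)) = no λ ()
child? (left _)  root              = no λ ()
child? (left u)  (left v)          = map′ left (λ { (left c) → c }) (child? u v)
child? (left _)  (right _)         = no λ ()
child? (right _) root              = no λ ()
child? (right _) (left _)          = no λ ()
child? (right u) (right v)         = map′ right (λ { (right c) → c }) (child? u v)

child-irrefl : ∀ {h} {v : Vertex h} → ¬ Child v v
child-irrefl (left c)  = child-irrefl c
child-irrefl (right c) = child-irrefl c

edges : ℕ → ℕ
edges zero    = zero
edges (suc h) = suc (edges h) + suc (edges h)

order : ℕ → ℕ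
order h = suc (edges h)

-- Vertices are numbered in preorder; the root gets zero.
decode : ∀ h → Fin (order h) → Vertex h
decode-⊎ : ∀ h → Fin (order h) ⊎ Fin (order h) → Vertex (suc h)

decode h       zero    = root
decode (suc h) (suc i) = decode-⊎ h (splitAt (order h) i)

decode-⊎ h (inj₁ i) = left (decode h i)
decode-⊎ h (inj₂ i) = right (decode h i)

encode : ∀ h → Vertex h → Fin (order h)
encode h       root      = zero
encode (suc h) (left v)  = suc (join (order h) (order h) (inj₁ (encode h v)))
encode (suc h) (right v) = suc (join (order h) (order h) (inj₂ (encode h v)))

decode-encode : ∀ h v → decode h (encode h v) ≡ v
decode-encode h       root      = refl
decode-encode (suc h) (left v)  =
  trans (cong (decode-⊎ h) (splitAt-join (order h) (order h) (inj₁ (encode h v))))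
        (cong left (decode-encode h v))
decode-encode (suc h) (right v) =
  trans (cong (decode-⊎ h) (splitAt-join (order h) (order h) (inj₂ (encode h v))))
        (cong right (decode-encode h v))

encode-decode : ∀ h i → encode h (decode h i) ≡ i
encode-decode-⊎ : ∀ h s →
  encode (suc h) (decode-⊎ h s) ≡ suc (join (order h) (order h) s)

encode-decode h       zero    = refl
encode-decode (suc h) (suc i) =
  trans (encode-decode-⊎ h (splitAt (order h) i))
        (cong suc (join-splitAt (order h) (order h) i))

encode-decode-⊎ h (inj₁ i) =
  cong (λ j → suc (join (order h) (order h) (inj₁ j))) (encode-decode h i)
encode-decode-⊎ h (inj₂ i) =
  cong (λ j → suc (join (order h) (order h) (inj₂ j))) (encode-decode h i)

numbering : ∀ h → Fin (order h) ↔ Vertex h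
numbering h = mk↔ₛ′ (decode h) (encode h) (decode-encode h) (encode-decode h)

T : ∀ h → Graph (order h)
T h = record
  { Adj        = λ i j → Child (vertex i) (vertex j) ⊎ Child (vertex j) (vertex i)
  ; adj?       = λ i j → child? (vertex i) (vertex j) ⊎-dec child? (vertex j) (vertex i)
  ; adj-sym    = swap
  ; adj-irrefl = λ { (inj₁ c) → child-irrefl c ; (inj₂ c) → child-irrefl c }
  }
  where
  vertex : Fin (order h) → Vertex h
  vertex = Inverse.to (numbering h)

rootOf : ∀ h → Fin (order h)
rootOf h = Inverse.from (numbering h) root

IsLeaf : ∀ h → Fin (order h) → Set
IsLeaf h ℓ = IsDistance (T h) (rootOf h) ℓ h

{-# OPTIONS --safe #-}
-- Classify the subsets of a subtree according to whether its root is chosen,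
-- is dominated within the subtree, or may wait to be dominated by its parent.
-- In each class only the least size and the number of sets attaining it
-- matter, and these are computed bottom-up.  The least sizes follow a pattern
-- of period 3 in the height, and the numbers multiply over the two child
-- subtrees.  Deleting a leaf of a tree of height 2 doubles the decisive
-- numbers without changing the least sizes, and each later step multiplies by
-- the numbers of an intact sibling subtree, so the factor 2 persists.

module Submission where

open import Defs
open import Data.Bool.Base using (Bool; true; false; _∧_; _∨_; not; if_then_else_)
  renaming (T to True)
open import Data.Bool.Properties using (T-≡; T-∧; T-∨; ∧-assoc; ∧-zeroʳ)
open import Data.Empty using (⊥-elim)
open import Data.Fin.Base using (Fin; zero; suc; punchIn; punchOut; _↑ˡ_; _↑ʳ_)
open import Data.Fin.Properties using (_≟_; punchInᵢ≢i; punchIn-punchOut)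
open import Data.Fin.Subset using (Subset; ∣_∣; inside; outside; _∈_)
open import Data.Fin.Subset.Properties using (∣p∣≤n)
open import Data.List.Base using ([]; _∷_; _++_; map; filter; length)
open import Data.List.Extrema.Nat using (min≈v⁺)
import Data.List.Membership.Propositional as List
open import Data.List.Membership.Propositional.Properties
  using (∈-map⁺; ∈-map⁻; ∈-filter⁺; ∈-filter⁻; ∈-++⁺ˡ; ∈-++⁺ʳ)
open import Data.List.Properties using (filter-++; length-++)
open import Data.List.Relation.Unary.All using (tabulate)
open import Data.List.Relation.Unary.Any using (here)
open import Data.Nat.Base using (ℕ; zero; suc; _+_; _*_; _≤_; _<_; z≤n; s≤s; _≡ᵇ_)
open import Data.Nat.Properties
  using (≤-trans; ≤-reflexive; ≤-refl; ≤-antisym; <⇒≤; suc-injective; ≡ᵇ⇒≡;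
         +-suc; +-comm; +-mono-≤; +-identityʳ; *-distribʳ-+; m≤n+m; m≤m+n)
  renaming (_≟_ to _≟ℕ_)
open import Data.Nat.Tactic.RingSolver using (solve-∀)
open import Data.Product.Base using (∃; ∃₂; _×_; _,_; proj₁; proj₂)
open import Data.Sum.Base using (_⊎_; inj₁; inj₂)
open import Data.Unit.Base using (tt)
open import Data.Vec.Base using ([]; _∷_; head; take; drop; lookup; insertAt)
open import Data.Vec.Properties
  using (insertAt-lookup; insertAt-punchIn; []=⇒lookup; lookup⇒[]=)
open import Function.Base using (_∘_; case_of_)
open import Function.Bundles using (Equivalence)
open import Relation.Binary.PropositionalEquality
  using (_≡_; _≢_; _≗_; refl; sym; trans; cong; cong₂; subst; subst₂; module ≡-Reasoning)
open import Relation.Nullary using (¬_; yes; no; does)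
open import Relation.Nullary.Decidable using (_×-dec_; dec-true; dec-false)
open import Relation.Unary using (Decidable)

private variable
  m n h a b p q : ℕ

-- Counting subsets

count : (Subset n → Bool) → ℕ
count {zero}  f = if f [] then 1 else 0
count {suc n} f = count (f ∘ (outside ∷_)) + count (f ∘ (inside ∷_))

count-cong : {f g : Subset n → Bool} → f ≗ g → count f ≡ count g
count-cong {zero}  f≗g rewrite f≗g [] = refl
count-cong {suc n} f≗g =
  cong₂ _+_ (count-cong (f≗g ∘ (outside ∷_))) (count-cong (f≗g ∘ (inside ∷_)))

count-none : (n : ℕ) → count {n} (λ _ → false) ≡ 0
count-none zero    = refl
count-none (suc n) = cong₂ _+_ (count-none n) (count-none n)

count-split : (b f : Subset n → Bool) →
  count f ≡ count (λ D → b D ∧ f D) + count (λ D → not (b D) ∧ f D)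
count-split {zero} b f with b []
... | true  = sym (+-identityʳ _)
... | false = refl
count-split {suc n} b f = trans
  (cong₂ _+_ (count-split (b ∘ (outside ∷_)) (f ∘ (outside ∷_)))
             (count-split (b ∘ (inside ∷_)) (f ∘ (inside ∷_))))
  (interchange (count λ D → b (outside ∷ D) ∧ f (outside ∷ D)) _ _ _)
  where
  interchange : ∀ w x y z → (w + x) + (y + z) ≡ (w + y) + (x + z)
  interchange = solve-∀

count-product : (f : Subset m → Bool) (g : Subset n → Bool) →
  count (λ E → f (take m E) ∧ g (drop m E)) ≡ count f * count g
count-product {zero} {n} f g with f []
... | true  = sym (+-identityʳ _)
... | false = count-none n
count-product {suc m} f g = trans
  (cong₂ _+_ (count-product (f ∘ (outside ∷_)) g) (count-product (f ∘ (inside ∷_)) g))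
  (sym (*-distribʳ-+ (count g) (count (f ∘ (outside ∷_))) _))

count-witness : (f : Subset n → Bool) → 0 < count f → ∃ λ D → True (f D)
count-witness {zero} f 0<c with f [] in eq
... | true = [] , subst True (sym eq) tt
count-witness {suc n} f 0<c with count (f ∘ (outside ∷_)) in eq
... | zero  = let D , fD = count-witness (f ∘ (inside ∷_)) 0<c in inside ∷ D , fD
... | suc _ = let D , fD = count-witness (f ∘ (outside ∷_)) (subst (0 <_) (sym eq) (s≤s z≤n))
              in outside ∷ D , fD

-- The half of the count in which `i` is chosen vanishes. This carries counts from subsets that
-- avoid a barred vertex to subsets of the vertex set without it.
count-insertAt : (f : Subset (suc n) → Bool) (i : Fin (suc n)) →
  (∀ D → lookup D i ≡ inside → f D ≡ false) →
  count f ≡ count (λ D → f (insertAt D i outside))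
count-insertAt {n} f zero avoids = trans
  (cong (count (f ∘ (outside ∷_)) +_)
    (trans (count-cong (λ D → avoids (inside ∷ D) refl)) (count-none n)))
  (+-identityʳ _)
count-insertAt {suc n} f (suc i) avoids = cong₂ _+_
  (count-insertAt (f ∘ (outside ∷_)) i (avoids ∘ (outside ∷_)))
  (count-insertAt (f ∘ (inside ∷_)) i (avoids ∘ (inside ∷_)))

length-filter-map : ∀ {A B : Set} {P : B → Set} (P? : Decidable P) (f : A → B) xs →
  length (filter P? (map f xs)) ≡ length (filter (P? ∘ f) xs)
length-filter-map P? f [] = refl
length-filter-map P? f (x ∷ xs) with does (P? (f x))
... | true  = cong suc (length-filter-map P? f xs)
... | false = length-filter-map P? f xs

length-filter-subsets : ∀ {P Q : Subset n → Set} (P? : Decidable P) (Q? : Decidable Q) →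
  length (filter Q? (filter P? (subsets n))) ≡ count (λ D → does (P? D) ∧ does (Q? D))
length-filter-subsets {n} P? Q? = trans (both (subsets n)) (counts n _)
  where
  both : ∀ xs → length (filter Q? (filter P? xs)) ≡ length (filter (λ D → P? D ×-dec Q? D) xs)
  both [] = refl
  both (x ∷ xs) with does (P? x)
  ... | false = both xs
  ... | true with does (Q? x)
  ...   | false = both xs
  ...   | true  = cong suc (both xs)
  counts : ∀ n {R : Subset n → Set} (R? : Decidable R) →
    length (filter R? (subsets n)) ≡ count (does ∘ R?)
  counts zero R? with does (R? [])
  ... | true  = refl
  ... | false = refl
  counts (suc n) R? = begin
    length (filter R? (map (outside ∷_) (subsets n) ++ map (inside ∷_) (subsets n)))
      ≡⟨ cong length (filter-++ R? (map (outside ∷_) (subsets n)) _) ⟩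
    length (filter R? (map (outside ∷_) (subsets n)) ++ filter R? (map (inside ∷_) (subsets n)))
      ≡⟨ length-++ (filter R? (map (outside ∷_) (subsets n))) ⟩
    length (filter R? (map (outside ∷_) (subsets n)))
      + length (filter R? (map (inside ∷_) (subsets n)))
      ≡⟨ cong₂ _+_ (length-filter-map R? (outside ∷_) (subsets n))
                   (length-filter-map R? (inside ∷_) (subsets n)) ⟩
    length (filter (R? ∘ (outside ∷_)) (subsets n))
      + length (filter (R? ∘ (inside ∷_)) (subsets n))
      ≡⟨ cong₂ _+_ (counts n _) (counts n _) ⟩
    count (does ∘ R?) ∎
    where open ≡-Reasoning

∈-subsets : (D : Subset n) → D List.∈ subsets n
∈-subsets [] = here refl
∈-subsets {suc n} (outside ∷ D) = ∈-++⁺ˡ (∈-map⁺ (outside ∷_) (∈-subsets D))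
∈-subsets {suc n} (inside ∷ D)  =
  ∈-++⁺ʳ (map (outside ∷_) (subsets n)) (∈-map⁺ (inside ∷_) (∈-subsets D))

∣∣-take-drop : ∀ m (E : Subset (m + n)) → ∣ E ∣ ≡ ∣ take m E ∣ + ∣ drop m E ∣
∣∣-take-drop zero    E             = refl
∣∣-take-drop (suc m) (outside ∷ E) = ∣∣-take-drop m E
∣∣-take-drop (suc m) (inside ∷ E)  = cong suc (∣∣-take-drop m E)

∣∣-insertAt-outside : (D : Subset n) (i : Fin (suc n)) → ∣ insertAt D i outside ∣ ≡ ∣ D ∣
∣∣-insertAt-outside D             zero    = refl
∣∣-insertAt-outside (outside ∷ D) (suc i) = ∣∣-insertAt-outside D i
∣∣-insertAt-outside (inside ∷ D)  (suc i) = cong suc (∣∣-insertAt-outside D i)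

-- Leading terms

-- The generating polynomial Σ x^∣D∣ of the sets D selected by f has the
-- form p x^a + higher order terms.  The coefficient p may be 0, in which
-- case only a lower bound on the sizes is asserted.
record Leading (f : Subset n → Bool) (a p : ℕ) : Set where
  field
    least : ∀ D → True (f D) → a ≤ ∣ D ∣
    tally : count (λ D → f D ∧ (∣ D ∣ ≡ᵇ a)) ≡ p

open Leading

leading-≡ : {f : Subset n → Bool} → a ≡ b → p ≡ q → Leading f a p → Leading f b q
leading-≡ refl refl L = L

leading-cong : {f g : Subset n → Bool} → f ≗ g → Leading f a p → Leading g a p
leading-cong f≗g L = record
  { least = λ D t → least L D (subst True (sym (f≗g D)) t)
  ; tally = trans (count-cong λ D → cong (_∧ _) (sym (f≗g D))) (tally L) }

<⇒≢ᵇ : a < b → (b ≡ᵇ a) ≡ false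
<⇒≢ᵇ {zero}  (s≤s _)   = refl
<⇒≢ᵇ {suc a} (s≤s a<b) = <⇒≢ᵇ a<b

leading-none : {f : Subset n → Bool} → (∀ D → f D ≡ false) → ∀ a → Leading f a 0
leading-none {n} none a = record
  { least = λ D t → ⊥-elim (subst True (none D) t)
  ; tally = trans (count-cong λ D → cong (_∧ (∣ D ∣ ≡ᵇ a)) (none D)) (count-none n) }

-- Sizes from `b` on leave nothing at a smaller exponent. This brings classes with different least
-- sizes to a common exponent before they are added.
leading-< : {f : Subset n → Bool} → a < b → Leading f b p → Leading f a 0
leading-< {n = n} {a = a} {f = f} a<b L = record
  { least = λ D t → ≤-trans (<⇒≤ a<b) (least L D t)
  ; tally = trans (count-cong none) (count-none n) }
  where
  none : ∀ D → f D ∧ (∣ D ∣ ≡ᵇ a) ≡ false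
  none D with f D | least L D
  ... | false | _  = refl
  ... | true  | ≤D = <⇒≢ᵇ (≤-trans a<b (≤D tt))

leading-split : (b : Subset n → Bool) {f : Subset n → Bool} →
  Leading (λ D → b D ∧ f D) a p → Leading (λ D → not (b D) ∧ f D) a q → Leading f a (p + q)
leading-split {a = a} b {f} L M = record
  { least = low
  ; tally = trans (count-split b (λ D → f D ∧ (∣ D ∣ ≡ᵇ a)))
      (cong₂ _+_
        (trans (count-cong λ D → sym (∧-assoc (b D) (f D) _)) (tally L))
        (trans (count-cong λ D → sym (∧-assoc (not (b D)) (f D) _)) (tally M))) }
  where
  low : ∀ D → True (f D) → a ≤ ∣ D ∣
  low D t with b D | least L D | least M D
  ... | true  | ≤D | _  = ≤D t
  ... | false | _  | ≤D = ≤D t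

leading-inside : {f : Subset (suc n) → Bool} →
  Leading (λ E → f (inside ∷ E)) a p → Leading (λ D → head D ∧ f D) (suc a) p
leading-inside {n} L = record
  { least = λ { (inside ∷ E) t → s≤s (least L E t) }
  ; tally = cong₂ _+_ (count-none n) (tally L) }

leading-outside : {f : Subset (suc n) → Bool} →
  Leading (λ E → f (outside ∷ E)) a p → Leading (λ D → not (head D) ∧ f D) a p
leading-outside {n} L = record
  { least = λ { (outside ∷ E) t → least L E t }
  ; tally = trans (cong₂ _+_ (tally L) (count-none n)) (+-identityʳ _) }

-- Under the two lower bounds an excess in one summand cannot be made up by the other.
≡ᵇ-+ : ∀ {s t} → a ≤ s → b ≤ t → (s + t ≡ᵇ a + b) ≡ (s ≡ᵇ a) ∧ (t ≡ᵇ b)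
≡ᵇ-+ {s = zero}      z≤n       b≤t = refl
≡ᵇ-+ {s = suc s} {t} z≤n       b≤t = <⇒≢ᵇ (s≤s (≤-trans b≤t (m≤n+m t s)))
≡ᵇ-+                 (s≤s a≤s) b≤t = ≡ᵇ-+ a≤s b≤t

-- Sizes over the two parts add, so the generating polynomials multiply. Zero coefficients are
-- harmless, since the lower bounds alone force a set of size `a + b` to be tight on both parts.
leading-product : {f : Subset m → Bool} {g : Subset n → Bool} →
  Leading f a p → Leading g b q →
  Leading (λ E → f (take m E) ∧ g (drop m E)) (a + b) (p * q)
leading-product {m = m} {a = a} {b = b} {f = f} {g} L M = record
  { least = low
  ; tally = trans (count-cong factor)
      (trans (count-product (λ D → f D ∧ (∣ D ∣ ≡ᵇ a)) (λ D → g D ∧ (∣ D ∣ ≡ᵇ b)))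
             (cong₂ _*_ (tally L) (tally M))) }
  where
  low : ∀ E → True (f (take m E) ∧ g (drop m E)) → a + b ≤ ∣ E ∣
  low E t rewrite ∣∣-take-drop m E
    with f (take m E) | g (drop m E) | least L (take m E) | least M (drop m E)
  ... | true | true | a≤ | b≤ = +-mono-≤ (a≤ tt) (b≤ tt)
  factor : ∀ E → (f (take m E) ∧ g (drop m E)) ∧ (∣ E ∣ ≡ᵇ a + b)
    ≡ (f (take m E) ∧ (∣ take m E ∣ ≡ᵇ a)) ∧ (g (drop m E) ∧ (∣ drop m E ∣ ≡ᵇ b))
  factor E rewrite ∣∣-take-drop m E
    with f (take m E) | g (drop m E) | least L (take m E) | least M (drop m E)
  ... | true  | true  | a≤ | b≤ = ≡ᵇ-+ (a≤ tt) (b≤ tt)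
  ... | true  | false | _  | _  = sym (∧-zeroʳ _)
  ... | false | _     | _  | _  = refl

leading-insertAt : {f : Subset (suc n) → Bool} (i : Fin (suc n)) →
  (∀ D → lookup D i ≡ inside → f D ≡ false) →
  Leading f a p → Leading (λ D → f (insertAt D i outside)) a p
leading-insertAt {a = a} {f = f} i avoids L = record
  { least = λ D t → subst (_ ≤_) (∣∣-insertAt-outside D i) (least L (insertAt D i outside) t)
  ; tally = trans
      (trans (count-cong λ D → cong (λ s → f (insertAt D i outside) ∧ (s ≡ᵇ _))
                                     (sym (∣∣-insertAt-outside D i)))
        (sym (count-insertAt _ i λ D D∋i → cong (_∧ (∣ D ∣ ≡ᵇ a)) (avoids D D∋i))))
      (tally L) }

-- Positivity of `p` yields a dominating set of size `a`, which turns the lower bound into the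
-- minimum.
leading-dominating : (G : Graph n) {f : Subset n → Bool} →
  (∀ {D} → Dominating G D → True (f D)) → (∀ {D} → True (f D) → Dominating G D) →
  Leading f a p → 0 < p → γ G ≡ a × ζ G ≡ p
leading-dominating {n} {a} {p} G {f} sound complete L 0<p = γ≡a , (begin
  ζ G
    ≡⟨ length-filter-subsets (dominating? G) (λ D → ∣ D ∣ ≟ℕ γ G) ⟩
  count (λ D → does (dominating? G D) ∧ (∣ D ∣ ≡ᵇ γ G))
    ≡⟨ count-cong (λ D → cong₂ (λ x g → x ∧ (∣ D ∣ ≡ᵇ g)) (agree D) γ≡a) ⟩
  count (λ D → f D ∧ (∣ D ∣ ≡ᵇ a))
    ≡⟨ tally L ⟩
  p ∎)
  where
  open ≡-Reasoning
  agree : ∀ D → does (dominating? G D) ≡ f D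
  agree D with f D in eq
  ... | true  = dec-true (dominating? G D) (complete (subst True (sym eq) tt))
  ... | false = dec-false (dominating? G D) (subst True eq ∘ sound)
  attained : ∃ λ D → Dominating G D × ∣ D ∣ ≡ a
  attained with count-witness _ (subst (0 <_) (sym (tally L)) 0<p)
  ... | D , t with f D in eq
  ...   | true = D , complete (subst True (sym eq) tt) , ≡ᵇ⇒≡ ∣ D ∣ a t
  γ≡a : γ G ≡ a
  γ≡a with attained
  ... | D , dom , refl = min≈v⁺
    (∈-map⁺ ∣_∣ (∈-filter⁺ (dominating? G) (∈-subsets D) dom))
    (tabulate λ s∈ → case ∈-map⁻ ∣_∣ s∈ of λ
      { (E , E∈ , refl) →
        least L E (sound (proj₂ (∈-filter⁻ (dominating? G) {xs = subsets n} E∈))) })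
    -- The default value `n` of the minimum does not undercut the size of `D`.
    (∣p∣≤n D)

-- Domination in a complete binary tree, recursively

-- The root is required to be dominated if r, and forbidden to be chosen
-- otherwise; x says whether it is chosen and y whether a neighbour is.
settled : (r x y : Bool) → Bool
settled r x y = if r then x ∨ y else not x

-- R tells which vertices are present, p whether the root is dominated
-- from outside the tree.
dominates : ∀ h → (Vertex h → Bool) → Bool → Subset (order h) → Bool
dominates zero    R p (x ∷ []) = settled (R root) x p
dominates (suc h) R p (x ∷ E)  =
  settled (R root) x (p ∨ (head (take (order h) E) ∨ head (drop (order h) E)))
    ∧ (dominates h (R ∘ left) x (take (order h) E)
    ∧  dominates h (R ∘ right) x (drop (order h) E))

-- taken: the root is chosen; closed: it is not, but a child is; helped: it is
-- not chosen and need not be dominated (as when its parent is chosen).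
record Profile (h : ℕ) (R : Vertex h → Bool) (t cₜ s cₛ o cₒ : ℕ) : Set where
  field
    taken  : Leading (λ D → head D ∧ dominates h R false D) t cₜ
    closed : Leading (λ D → not (head D) ∧ dominates h R false D) s cₛ
    helped : Leading (λ D → not (head D) ∧ dominates h R true D) o cₒ

open Profile

-- If the root is chosen, its own condition no longer depends on outside help, and the subtrees see
-- only that it is chosen. Hence one entry `taken` serves both values of the help.
taken-indifferent : ∀ h (R : Vertex h → Bool) D →
  head D ∧ dominates h R false D ≡ head D ∧ dominates h R true D
taken-indifferent zero    R (outside ∷ [])  = refl
taken-indifferent zero    R (inside ∷ [])  = refl
taken-indifferent (suc h) R (outside ∷ _) = refl
taken-indifferent (suc h) R (inside ∷ _) = refl

-- Recurrences for the leading terms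

module _ {h : ℕ} {R : Vertex h → Bool} where

  leading-alone : Leading (λ D → head D ∧ dominates h R false D) a p →
    Leading (λ D → not (head D) ∧ dominates h R false D) a q →
    Leading (dominates h R false) a (p + q)
  leading-alone = leading-split head

  leading-aided : Leading (λ D → head D ∧ dominates h R false D) a p →
    Leading (λ D → not (head D) ∧ dominates h R true D) a q →
    Leading (dominates h R true) a (p + q)
  leading-aided L = leading-split head (leading-cong (taken-indifferent h R) L)

module _ {h : ℕ} {R : Vertex (suc h) → Bool} (root∈R : R root ≡ true) where

  recurrence : ∀ p x E → dominates (suc h) R p (x ∷ E) ≡
    (x ∨ (p ∨ (head (take (order h) E) ∨ head (drop (order h) E))))
      ∧ (dominates h (R ∘ left) x (take (order h) E) ∧ dominates h (R ∘ right) x (drop (order h) E))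
  recurrence p x E rewrite root∈R = refl

  -- A chosen root helps both children; the additional 1 is the root itself.
  step-taken : Leading (dominates h (R ∘ left) true) a p →
    Leading (dominates h (R ∘ right) true) b q →
    Leading (λ D → head D ∧ dominates (suc h) R false D) (suc (a + b)) (p * q)
  step-taken L M = leading-inside
    (leading-cong (λ E → sym (recurrence false inside E)) (leading-product L M))

  -- Help from above settles the root, which is unchosen and so gives its children no help. No
  -- condition then links the two subtrees.
  step-helped : Leading (dominates h (R ∘ left) false) a p →
    Leading (dominates h (R ∘ right) false) b q →
    Leading (λ D → not (head D) ∧ dominates (suc h) R true D) (a + b) (p * q)
  step-helped L M = leading-outside
    (leading-cong (λ E → sym (recurrence true outside E)) (leading-product L M))

  -- Either the left child is chosen, or it is not and the right child is.
  step-alone : ∀ {c d} {p q r s} →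
    Leading (λ D → head D ∧ dominates h (R ∘ left) false D) a p →
    Leading (dominates h (R ∘ right) false) b q →
    Leading (λ D → not (head D) ∧ dominates h (R ∘ left) false D) c r →
    Leading (λ D → head D ∧ dominates h (R ∘ right) false D) d s →
    a + b ≡ c + d →
    Leading (λ D → not (head D) ∧ dominates (suc h) R false D) (a + b) (p * q + r * s)
  step-alone L₁ M₁ L₂ M₂ a+b≡c+d = leading-outside (leading-split (λ E → head (take (order h) E))
    (leading-cong (λ E → rearrange₁ {head (take (order h) E)} (recurrence false outside E))
      (leading-product L₁ M₁))
    (leading-cong (λ E → rearrange₂ {head (take (order h) E)} (recurrence false outside E))
      (leading-≡ (sym a+b≡c+d) refl (leading-product L₂ M₂))))
    where
    rearrange₁ : ∀ {x y f g z} → z ≡ (x ∨ y) ∧ (f ∧ g) → (x ∧ f) ∧ g ≡ x ∧ z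
    rearrange₁ {true}  z≡ = sym z≡
    rearrange₁ {false} z≡ = refl
    rearrange₂ : ∀ {x y f g z} → z ≡ (x ∨ y) ∧ (f ∧ g) → (not x ∧ f) ∧ (y ∧ g) ≡ not x ∧ z
    rearrange₂ {true}                  z≡ = refl
    rearrange₂ {false} {true}          z≡ = sym z≡
    rearrange₂ {false} {false} {f = f} z≡ = trans (∧-zeroʳ f) (sym z≡)

-- The invariants at heights h ≡ 0, 1, 2 mod 3: d = 1 for the complete tree and
-- d = 2 for the tree without a leaf.  Terms of coefficient 0 never contribute
-- to the leading terms at the next height.
Phase₀ Phase₁ Phase₂ : (k d : ℕ) → ∀ {h} → (Vertex h → Bool) → Set
Phase₀ k d {h} R = Profile h R (suc k) d (suc k) (2 * d) k d
Phase₁ k d {h} R = Profile h R k d k 0 k 0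
Phase₂ k d {h} R = Profile h R (suc k) d k d k d

module _ {h k d : ℕ} {R : Vertex h → Bool} where

  alone₀ : Phase₀ k d R → Leading (dominates h R false) (suc k) (3 * d)
  -- The coefficients `d` of `taken` and `2 * d` of `closed` add up to `3 * d` by computation.
  alone₀ P = leading-alone {h} (taken P) (closed P)

  aided₀ : Phase₀ k d R → Leading (dominates h R true) k d
  aided₀ P = leading-aided {h} (leading-< ≤-refl (taken P)) (helped P)

  alone₁ : Phase₁ k d R → Leading (dominates h R false) k d
  alone₁ P = leading-≡ refl (+-identityʳ d)
    (leading-alone {h} (taken P) (closed P))

  aided₁ : Phase₁ k d R → Leading (dominates h R true) k d
  aided₁ P = leading-≡ refl (+-identityʳ d)
    (leading-aided {h} (taken P) (helped P))

  alone₂ : Phase₂ k d R → Leading (dominates h R false) k d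
  alone₂ P = leading-alone {h} (leading-< ≤-refl (taken P)) (closed P)

  aided₂ : Phase₂ k d R → Leading (dominates h R true) k d
  aided₂ P = leading-aided {h} (leading-< ≤-refl (taken P)) (helped P)

module _ {h k d e : ℕ} {R : Vertex (suc h) → Bool} (root∈R : R root ≡ true) where

  2⇒0 : Phase₂ k d (R ∘ left) → Phase₂ k e (R ∘ right) → Phase₀ (k + k) (d * e) R
  2⇒0 P Q = record
    { taken  = step-taken {R = R} root∈R (aided₂ P) (aided₂ Q)
    -- Each of the two alternatives of `step-alone` contributes `d * e`; this is the factor 2 in
    -- `Phase₀`.
    ; closed = leading-≡ refl (cong (d * e +_) (sym (+-identityʳ _)))
        (step-alone {R = R} root∈R (taken P) (alone₂ Q) (closed P) (taken Q) (+-comm (suc k) k))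
    ; helped = step-helped {R = R} root∈R (alone₂ P) (alone₂ Q)
    }

  0⇒1 : Phase₀ k d (R ∘ left) → Phase₀ k e (R ∘ right) → Phase₁ (suc (k + k)) (d * e) R
  0⇒1 P Q = record
    { taken  = step-taken {R = R} root∈R (aided₀ P) (aided₀ Q)
    -- With the root unchosen each subtree costs `suc k`, in total one more than choosing the root
    -- and aiding both children. So `closed` and `helped` get coefficient 0.
    ; closed = leading-< (≤-reflexive (cong suc (sym (+-suc k k))))
        (step-alone {R = R} root∈R (taken P) (alone₀ Q) (closed P) (taken Q) refl)
    ; helped = leading-< (≤-reflexive (cong suc (sym (+-suc k k))))
        (step-helped {R = R} root∈R (alone₀ P) (alone₀ Q))
    }

  1⇒2 : Phase₁ k d (R ∘ left) → Phase₁ k e (R ∘ right) → Phase₂ (k + k) (d * e) R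
  1⇒2 P Q = record
    { taken  = step-taken {R = R} root∈R (aided₁ P) (aided₁ Q)
    -- The alternative with the left child unchosen contributes `0 * e`, because `closed P` has
    -- coefficient 0.
    ; closed = leading-≡ refl (+-identityʳ _)
        (step-alone {R = R} root∈R
          (taken P) (alone₁ Q) (closed P) (taken Q) refl)
    ; helped = step-helped {R = R} root∈R (alone₁ P) (alone₁ Q)
    }

-- Intact and pruned trees of height at most 2

depth : Vertex h → ℕ
depth root      = 0
depth (left v)  = suc (depth v)
depth (right v) = suc (depth v)

Full : (Vertex h → Bool) → Set
Full R = ∀ v → R v ≡ true

Missing : (Vertex h → Bool) → Vertex h → Set
Missing R ℓ = R ℓ ≡ false × (∀ v → v ≢ ℓ → R v ≡ true)

module _ {R : Vertex (suc h) → Bool} {ℓ : Vertex h} where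

  missing-left : Missing R (left ℓ) → Missing (R ∘ left) ℓ × Full (R ∘ right) × R root ≡ true
  missing-left (ℓ∉R , ∈R) =
    (ℓ∉R , λ v v≢ℓ → ∈R (left v) λ { refl → v≢ℓ refl }) , (λ v → ∈R (right v) λ ()) , ∈R root λ ()

  missing-right : Missing R (right ℓ) → Full (R ∘ left) × Missing (R ∘ right) ℓ × R root ≡ true
  missing-right (ℓ∉R , ∈R) =
    (λ v → ∈R (left v) λ ()) , (ℓ∉R , λ v v≢ℓ → ∈R (right v) λ { refl → v≢ℓ refl }) , ∈R root λ ()

leading-[] : (f : Subset 0 → Bool) → f [] ≡ true → Leading f 0 1
leading-[] f f[] = record
  { least = λ _ _ → z≤n
  ; tally = cong (λ b → if b ∧ true then 1 else 0) f[]
  }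

-- A leaf without help must choose itself, so `closed` is void. Its coefficient 0, where `Phase₀`
-- would ask for 2, keeps height 0 outside the pattern.
full₀ : {R : Vertex 0 → Bool} → Full R → Profile 0 R 1 1 1 0 0 1
full₀ {R} full = record
  { taken  = leading-inside (leading-[] _ (cong (λ r → settled r true false) (full root)))
  ; closed = leading-none none 1
  ; helped = leading-outside (leading-[] _ (cong (λ r → settled r false true) (full root)))
  }
  where
  none : ∀ D → not (head D) ∧ dominates 0 R false D ≡ false
  none (inside ∷ [])  = refl
  none (outside ∷ []) = cong (λ r → settled r false false) (full root)

-- An absent leaf demands nothing, so the empty set already counts as `closed`.
missing₀ : {R : Vertex 0 → Bool} → R root ≡ false → Profile 0 R 0 0 0 1 0 1
missing₀ {R} root∉R = record
  { taken  = leading-none none 0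
  ; closed = leading-outside (leading-[] _ (cong (λ r → settled r false false) root∉R))
  ; helped = leading-outside (leading-[] _ (cong (λ r → settled r false true) root∉R))
  }
  where
  none : ∀ D → head D ∧ dominates 0 R false D ≡ false
  none (outside ∷ []) = refl
  none (inside ∷ [])  = cong (λ r → settled r true false) root∉R

full₁ : {R : Vertex 1 → Bool} → Full R → Profile 1 R 1 1 2 1 2 1
full₁ {R} full = record
  { taken  = step-taken {R = R} (full root) (aided P) (aided Q)
  ; closed = step-alone {R = R} (full root) (taken P) (alone Q) (closed P) (taken Q) refl
  ; helped = step-helped {R = R} (full root) (alone P) (alone Q)
  }
  where
  P : Profile 0 (R ∘ left) 1 1 1 0 0 1
  P = full₀ (full ∘ left)
  Q : Profile 0 (R ∘ right) 1 1 1 0 0 1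
  Q = full₀ (full ∘ right)
  alone : {S : Vertex 0 → Bool} → Profile 0 S 1 1 1 0 0 1 → Leading (dominates 0 S false) 1 1
  alone P = leading-alone {0} (taken P) (closed P)
  aided : {S : Vertex 0 → Bool} → Profile 0 S 1 1 1 0 0 1 → Leading (dominates 0 S true) 0 1
  aided P = leading-aided {0} (leading-< ≤-refl (taken P)) (helped P)

-- What remains is a single edge, dominated by either end. So `closed` and `helped` attain the size
-- 1 of `taken`, while in `full₁` they need both leaves.
missing₁ : {R : Vertex 1 → Bool} (ℓ : Vertex 1) → depth ℓ ≡ 1 → Missing R ℓ →
  Profile 1 R 1 1 1 1 1 1
missing₁ {R} (left root) _ mis with missing-left {R = R} mis
... | (ℓ∉R , _) , full , root∈R = record
  { taken  = step-taken {R = R} root∈R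
      (leading-aided {0} (taken P) (helped P))
      (leading-aided {0} (leading-< ≤-refl (taken Q)) (helped Q))
  ; closed = step-alone {R = R} root∈R
      (taken P) (leading-alone {0} (taken Q) (closed Q)) (closed P) (taken Q) refl
  ; helped = step-helped {R = R} root∈R
      (leading-alone {0} (taken P) (closed P)) (leading-alone {0} (taken Q) (closed Q))
  }
  where
  P = missing₀ {R ∘ left} ℓ∉R
  Q = full₀ {R ∘ right} full
missing₁ {R} (right root) _ mis with missing-right {R = R} mis
... | full , (ℓ∉R , _) , root∈R = record
  { taken  = step-taken {R = R} root∈R
      (leading-aided {0} (leading-< ≤-refl (taken P)) (helped P))
      (leading-aided {0} (taken Q) (helped Q))
  ; closed = step-alone {R = R} root∈R
      (taken P) (leading-alone {0} (taken Q) (closed Q)) (closed P) (taken Q) refl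
  ; helped = step-helped {R = R} root∈R
      (leading-alone {0} (taken P) (closed P)) (leading-alone {0} (taken Q) (closed Q))
  }
  where
  P = full₀ {R ∘ left} full
  Q = missing₀ {R ∘ right} ℓ∉R

weaken₁ : {R : Vertex 1 → Bool} → Profile 1 R 1 1 2 1 2 1 → Phase₁ 1 1 R
weaken₁ P = record
  { taken = taken P ; closed = leading-< ≤-refl (closed P) ; helped = leading-< ≤-refl (helped P) }

-- The factor 2 arises here. Size 1 suffices for the pruned child subtree in all three classes, but
-- for its intact sibling only with its root chosen; so the pruned side has two options where an
-- intact one has one.
missing₂ : {R : Vertex 2 → Bool} (ℓ : Vertex 2) → depth ℓ ≡ 2 → Missing R ℓ → Phase₂ 2 2 R
missing₂ {R} (left ℓ) eq mis with missing-left {R = R} mis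
... | misˡ , full , root∈R = record
  { taken  = step-taken {R = R} root∈R (leading-aided {1} (taken P) (helped P)) (aided₁ Q)
  ; closed = step-alone {R = R} root∈R (taken P) (alone₁ Q) (closed P) (taken Q) refl
  ; helped = step-helped {R = R} root∈R (leading-alone {1} (taken P) (closed P)) (alone₁ Q)
  }
  where
  P = missing₁ {R ∘ left} ℓ (suc-injective eq) misˡ
  Q = weaken₁ (full₁ {R ∘ right} full)
missing₂ {R} (right ℓ) eq mis with missing-right {R = R} mis
... | full , misʳ , root∈R = record
  { taken  = step-taken {R = R} root∈R (aided₁ P) (leading-aided {1} (taken Q) (helped Q))
  -- With the pruned subtree on the right, both options fall under the chosen left child; the other
  -- alternative has coefficient 0.
  ; closed = step-alone {R = R} root∈R
      (taken P) (leading-alone {1} (taken Q) (closed Q)) (closed P) (taken Q) refl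
  ; helped = step-helped {R = R} root∈R (alone₁ P) (leading-alone {1} (taken Q) (closed Q))
  }
  where
  P = weaken₁ (full₁ {R ∘ left} full)
  Q = missing₁ {R ∘ right} ℓ (suc-injective eq) misʳ

-- Induction on the height

-- The shared `k` records that deletion keeps the least sizes, the coefficients 1 and 2 record the
-- doubling. Quantifying over `R` and `ℓ` lets the induction enter either child subtree.
Doubling : ((k d : ℕ) → ∀ {h} → (Vertex h → Bool) → Set) → ℕ → Set
Doubling Φ h = ∃ λ k →
  ((R : Vertex h → Bool) → Full R → Φ k 1 R) ×
  ((R : Vertex h → Bool) (ℓ : Vertex h) → depth ℓ ≡ h → Missing R ℓ → Φ k 2 R)

-- The deleted leaf lies in one child subtree and the sibling is intact with coefficient 1, so the
-- product is `2 * 1` or `1 * 2`.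
doubling-suc : {Φ Ψ : (k d : ℕ) → ∀ {h} → (Vertex h → Bool) → Set} (next : ℕ → ℕ) →
  (∀ {k d e} {R : Vertex (suc h) → Bool} → R root ≡ true →
    Φ k d (R ∘ left) → Φ k e (R ∘ right) → Ψ (next k) (d * e) R) →
  Doubling Φ h → Doubling Ψ (suc h)
doubling-suc {h} {Φ} {Ψ} next grow (k , whole , pruned) = next k , whole′ , pruned′
  where
  whole′ : (R : Vertex (suc h) → Bool) → Full R → Ψ (next k) 1 R
  whole′ R full = grow (full root) (whole _ (full ∘ left)) (whole _ (full ∘ right))
  pruned′ : (R : Vertex (suc h) → Bool) (ℓ : Vertex (suc h)) → depth ℓ ≡ suc h →
    Missing R ℓ → Ψ (next k) 2 R
  pruned′ R (left ℓ) eq mis =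
    let misˡ , full , root∈R = missing-left {R = R} mis
    in grow root∈R (pruned _ ℓ (suc-injective eq) misˡ) (whole _ full)
  pruned′ R (right ℓ) eq mis =
    let full , misʳ , root∈R = missing-right {R = R} mis
    in grow root∈R (whole _ full) (pruned _ ℓ (suc-injective eq) misʳ)

data Regular (h : ℕ) : Set where
  phase₀ : Doubling Phase₀ h → Regular h
  phase₁ : Doubling Phase₁ h → Regular h
  phase₂ : Doubling Phase₂ h → Regular h

regular : 2 ≤ h → Regular h
regular {suc zero} (s≤s ())
-- The constant 2 is `1 + 1`, as given by `1⇒2`. The complete tree fits the phases from height 1 on,
-- the pruned one only from height 2, so its case is computed directly.
regular {suc (suc zero)} _ = phase₂ (2 ,
  (λ R full → 1⇒2 {R = R} (full root)
    (weaken₁ (full₁ (full ∘ left))) (weaken₁ (full₁ (full ∘ right)))) ,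
  (λ R → missing₂))
regular {suc (suc (suc h))} _ with regular {suc (suc h)} (s≤s (s≤s z≤n))
... | phase₀ D = phase₁ (doubling-suc {Φ = Phase₀} {Ψ = Phase₁} _ 0⇒1 D)
... | phase₁ D = phase₂ (doubling-suc {Φ = Phase₁} {Ψ = Phase₂} _ 1⇒2 D)
... | phase₂ D = phase₀ (doubling-suc {Φ = Phase₂} {Ψ = Phase₀} _ 2⇒0 D)

leading-doubles : Regular h → ∃₂ λ a m → 0 < m ×
  ((R : Vertex h → Bool) → Full R → Leading (dominates h R false) a m) ×
  ((R : Vertex h → Bool) (ℓ : Vertex h) → depth ℓ ≡ h → Missing R ℓ →
    Leading (dominates h R false) a (2 * m))
-- Since `alone₀` multiplies by 3, the coefficients are 3 for `d = 1` and 6 for `d = 2`.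
leading-doubles (phase₀ (k , whole , pruned)) = suc k , 3 , s≤s z≤n ,
  (λ R → alone₀ ∘ whole R) , (λ R ℓ eq → alone₀ ∘ pruned R ℓ eq)
leading-doubles (phase₁ (k , whole , pruned)) = k , 1 , s≤s z≤n ,
  (λ R → alone₁ ∘ whole R) , (λ R ℓ eq → alone₁ ∘ pruned R ℓ eq)
leading-doubles (phase₂ (k , whole , pruned)) = k , 1 , s≤s z≤n ,
  (λ R → alone₂ ∘ whole R) , (λ R ℓ eq → alone₂ ∘ pruned R ℓ eq)

-- From the recursion to dominating sets

lookup-take : ∀ m (E : Subset (m + n)) i → lookup (take m E) i ≡ lookup E (i ↑ˡ n)
lookup-take (suc m) (x ∷ E) zero    = refl
lookup-take (suc m) (x ∷ E) (suc i) = lookup-take m E i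

lookup-drop : ∀ m (E : Subset (m + n)) i → lookup (drop m E) i ≡ lookup E (m ↑ʳ i)
lookup-drop zero    E       i = refl
lookup-drop (suc m) (x ∷ E) i = lookup-drop m E i

infix 4 _∋_
_∋_ : Subset (order h) → Vertex h → Set
_∋_ {h} D v = True (lookup D (encode h v))

head≡lookup-zero : (D : Subset (suc n)) → head D ≡ lookup D zero
head≡lookup-zero (x ∷ D) = refl

module Branches (h : ℕ) (x : Bool) (E : Subset (order h + order h)) where

  D : Subset (order (suc h))
  D = x ∷ E

  ∋-left⁺ : ∀ v → take (order h) E ∋ v → D ∋ left v
  ∋-left⁺ v = subst True (lookup-take (order h) E (encode h v))

  ∋-left⁻ : ∀ v → D ∋ left v → take (order h) E ∋ v
  ∋-left⁻ v = subst True (sym (lookup-take (order h) E (encode h v)))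

  ∋-right⁺ : ∀ v → drop (order h) E ∋ v → D ∋ right v
  ∋-right⁺ v = subst True (lookup-drop (order h) E (encode h v))

  ∋-right⁻ : ∀ v → D ∋ right v → drop (order h) E ∋ v
  ∋-right⁻ v = subst True (sym (lookup-drop (order h) E (encode h v)))

  head-left : head (take (order h) E) ≡ lookup D (encode (suc h) (left root))
  head-left = trans (head≡lookup-zero (take (order h) E)) (lookup-take (order h) E zero)

  head-right : head (drop (order h) E) ≡ lookup D (encode (suc h) (right root))
  head-right = trans (head≡lookup-zero (drop (order h) E)) (lookup-drop (order h) E zero)

Covered : Bool → Subset (order h) → Vertex h → Set
Covered p D v = (v ≡ root × True p) ⊎ D ∋ v ⊎ ∃ λ u → (Child v u ⊎ Child u v) × D ∋ u

-- Covering vertices lie in `D` and so are present. For `p` false this is domination in the subgraph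
-- induced on the present vertices; for `p` true the root is excused.
Spec : (Vertex h → Bool) → Bool → Subset (order h) → Set
Spec R p D = (∀ v → D ∋ v → True (R v)) × (∀ v → True (R v) → Covered p D v)

settled⁺ : ∀ {r x y} → (True x → True r) → (True r → True x ⊎ True y) → True (settled r x y)
settled⁺ {false} {false} _ _ = tt
settled⁺ {false} {true}  f _ = f tt
settled⁺ {true}  {x}     _ g = Equivalence.from T-∨ (g tt)

settled⁻ : ∀ r {x y} → True (settled r x y) → (True x → True r) × (True r → True x ⊎ True y)
settled⁻ false {false} _ = (λ ()) , λ ()
settled⁻ true          t = (λ _ → tt) , λ _ → Equivalence.to T-∨ t

dominates⁻ : ∀ h {R : Vertex h → Bool} {p} (D : Subset (order h)) →
  True (dominates h R p D) → Spec R p D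
dominates⁻ zero {R} (x ∷ []) t with settled⁻ (R root) t
... | x⇒r , r⇒ = (λ { root → x⇒r }) , λ { root r → case r⇒ r of λ
  { (inj₁ x) → inj₂ (inj₁ x) ; (inj₂ p) → inj₁ (refl , p) } }
dominates⁻ (suc h) {R} {p} (x ∷ E) t
  with tᵣ , t′ ← Equivalence.to T-∧ t
  with tˡ , tʳ ← Equivalence.to T-∧ t′
  with x⇒r , r⇒ ← settled⁻ (R root) tᵣ
     | inˡ , covˡ ← dominates⁻ h {R ∘ left} (take (order h) E) tˡ
     | inʳ , covʳ ← dominates⁻ h {R ∘ right} (drop (order h) E) tʳ
  = (λ { root → x⇒r ; (left v) → inˡ v ∘ ∋-left⁻ v ; (right v) → inʳ v ∘ ∋-right⁻ v }) , cov
  where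
  open Branches h x E
  cov : ∀ v → True (R v) → Covered p (x ∷ E) v
  cov root r with r⇒ r
  ... | inj₁ x∈ = inj₂ (inj₁ x∈)
  ... | inj₂ t with Equivalence.to (T-∨ {p}) t
  ...   | inj₁ p∈ = inj₁ (refl , p∈)
  ...   | inj₂ t with Equivalence.to (T-∨ {head (take (order h) E)}) t
  ...     | inj₁ c = inj₂ (inj₂ (left root , inj₁ root-left , subst True head-left c))
  ...     | inj₂ c = inj₂ (inj₂ (right root , inj₁ root-right , subst True head-right c))
  cov (left v) r with covˡ v r
  ... | inj₁ (refl , x∈) = inj₂ (inj₂ (root , inj₂ root-left , x∈))
  ... | inj₂ (inj₁ v∈) = inj₂ (inj₁ (∋-left⁺ v v∈))
  ... | inj₂ (inj₂ (u , inj₁ c , u∈)) = inj₂ (inj₂ (left u , inj₁ (left c) , ∋-left⁺ u u∈))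
  ... | inj₂ (inj₂ (u , inj₂ c , u∈)) = inj₂ (inj₂ (left u , inj₂ (left c) , ∋-left⁺ u u∈))
  cov (right v) r with covʳ v r
  ... | inj₁ (refl , x∈) = inj₂ (inj₂ (root , inj₂ root-right , x∈))
  ... | inj₂ (inj₁ v∈) = inj₂ (inj₁ (∋-right⁺ v v∈))
  ... | inj₂ (inj₂ (u , inj₁ c , u∈)) = inj₂ (inj₂ (right u , inj₁ (right c) , ∋-right⁺ u u∈))
  ... | inj₂ (inj₂ (u , inj₂ c , u∈)) = inj₂ (inj₂ (right u , inj₂ (right c) , ∋-right⁺ u u∈))

dominates⁺ : ∀ h {R : Vertex h → Bool} {p} (D : Subset (order h)) →
  Spec R p D → True (dominates h R p D)
dominates⁺ zero {R} (x ∷ []) (in? , cov) = settled⁺ {R root} (in? root) λ r → case cov root r of λ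
  { (inj₁ (_ , p)) → inj₂ p
  ; (inj₂ (inj₁ x)) → inj₁ x
  ; (inj₂ (inj₂ (root , inj₁ () , _)))
  ; (inj₂ (inj₂ (root , inj₂ () , _))) }
dominates⁺ (suc h) {R} {p} (x ∷ E) (in? , cov) = Equivalence.from T-∧
  ( settled⁺ {R root} (in? root) covᵣ
  , Equivalence.from T-∧
    ( dominates⁺ h (take (order h) E) ((λ v → in? (left v) ∘ ∋-left⁺ v) , covˡ)
    , dominates⁺ h (drop (order h) E) ((λ v → in? (right v) ∘ ∋-right⁺ v) , covʳ)))
  where
  open Branches h x E
  covᵣ : True (R root) → True x ⊎ True (p ∨ (head (take (order h) E) ∨ head (drop (order h) E)))
  covᵣ r with cov root r
  ... | inj₁ (_ , p∈) = inj₂ (Equivalence.from (T-∨ {p}) (inj₁ p∈))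
  ... | inj₂ (inj₁ x∈) = inj₁ x∈
  ... | inj₂ (inj₂ (_ , inj₁ root-left , c)) = inj₂ (Equivalence.from (T-∨ {p}) (inj₂
    (Equivalence.from (T-∨ {head (take (order h) E)}) (inj₁ (subst True (sym head-left) c)))))
  ... | inj₂ (inj₂ (_ , inj₁ root-right , c)) = inj₂ (Equivalence.from (T-∨ {p}) (inj₂
    (Equivalence.from (T-∨ {head (take (order h) E)})
      (inj₂ (subst True (sym head-right) c)))))
  covˡ : ∀ v → True (R (left v)) → Covered x (take (order h) E) v
  covˡ v r with cov (left v) r
  ... | inj₂ (inj₁ v∈) = inj₂ (inj₁ (∋-left⁻ v v∈))
  ... | inj₂ (inj₂ (left u , inj₁ (left c) , u∈)) = inj₂ (inj₂ (_ , inj₁ c , ∋-left⁻ u u∈))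
  ... | inj₂ (inj₂ (left u , inj₂ (left c) , u∈)) = inj₂ (inj₂ (_ , inj₂ c , ∋-left⁻ u u∈))
  -- The edge to the root is the only one leaving the subtree; it turns into the outside help `x`.
  ... | inj₂ (inj₂ (_ , inj₂ root-left , x∈)) = inj₁ (refl , x∈)
  covʳ : ∀ v → True (R (right v)) → Covered x (drop (order h) E) v
  covʳ v r with cov (right v) r
  ... | inj₂ (inj₁ v∈) = inj₂ (inj₁ (∋-right⁻ v v∈))
  ... | inj₂ (inj₂ (right u , inj₁ (right c) , u∈)) = inj₂ (inj₂ (_ , inj₁ c , ∋-right⁻ u u∈))
  ... | inj₂ (inj₂ (right u , inj₂ (right c) , u∈)) = inj₂ (inj₂ (_ , inj₂ c , ∋-right⁻ u u∈))
  ... | inj₂ (inj₂ (_ , inj₂ root-right , x∈)) = inj₁ (refl , x∈)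

∈⇒True : ∀ {i} {D : Subset n} → i ∈ D → True (lookup D i)
∈⇒True i∈D = subst True (sym ([]=⇒lookup i∈D)) tt

True⇒∈ : ∀ {i} {D : Subset n} → True (lookup D i) → i ∈ D
True⇒∈ {i = i} {D} t = lookup⇒[]= i D (Equivalence.to T-≡ t)

Dominated : Graph n → Subset n → Fin n → Set
Dominated G D i = i ∈ D ⊎ ∃ λ j → Adj G i j × j ∈ D

module _ {h : ℕ} {r : Fin (order h) → Bool} {D : Subset (order h)} where

  -- The outside help is `false` since the root of the whole tree has no parent. A constantly true
  -- `r` gives domination in `T h`; `other` below gives it for the tree without a vertex.
  present-dominated⁻ : True (dominates h (r ∘ encode h) false D) →
    (∀ i → i ∈ D → True (r i)) × (∀ i → True (r i) → Dominated (T h) D i)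
  present-dominated⁻ t with in? , cov ← dominates⁻ h D t =
    (λ i i∈D → subst (True ∘ r) (encode-decode h i)
      (in? (decode h i) (subst (True ∘ lookup D) (sym (encode-decode h i)) (∈⇒True i∈D)))) ,
    λ i ri → case cov (decode h i) (subst (True ∘ r) (sym (encode-decode h i)) ri) of λ
      { (inj₂ (inj₁ i∈D)) → inj₁ (True⇒∈ (subst (True ∘ lookup D) (encode-decode h i) i∈D))
      ; (inj₂ (inj₂ (u , adj , u∈D))) → inj₂ (encode h u ,
          subst (λ w → Child (decode h i) w ⊎ Child w (decode h i)) (sym (decode-encode h u)) adj ,
          True⇒∈ u∈D) }

  present-dominated⁺ : (∀ i → i ∈ D → True (r i)) → (∀ i → True (r i) → Dominated (T h) D i) →
    True (dominates h (r ∘ encode h) false D)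
  present-dominated⁺ in? dom = dominates⁺ h D
    ( (λ v v∈D → in? (encode h v) (True⇒∈ v∈D))
    , λ v rv → case dom (encode h v) rv of λ
      { (inj₁ v∈D) → inj₂ (inj₁ (∈⇒True v∈D))
      ; (inj₂ (j , adj , j∈D)) → inj₂ (inj₂ (decode h j ,
          subst (λ w → Child w (decode h j) ⊎ Child (decode h j) w) (decode-encode h v) adj ,
          subst (True ∘ lookup D) (sym (encode-decode h j)) (∈⇒True j∈D))) })

-- Distance from the root and depth

depth≤h : (v : Vertex h) → depth v ≤ h
depth≤h root      = z≤n
depth≤h (left v)  = s≤s (depth≤h v)
depth≤h (right v) = s≤s (depth≤h v)

-- The embedding `f` lets the induction pass to subtrees while the walk stays in the whole tree.
descent : ∀ {h′} (f : Vertex h → Vertex h′) → (∀ {u v} → Child u v → Child (f u) (f v)) →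
  ∀ v → Walk (T h′) (encode h′ (f root)) (encode h′ (f v)) (depth v)
descent f f-child root = stop
descent {suc h} {h′} f f-child (left v) =
  step (inj₁ (subst₂ Child (sym (decode-encode h′ _)) (sym (decode-encode h′ _))
    (f-child root-left)))
       (descent (f ∘ left) (f-child ∘ left) v)
descent {suc h} {h′} f f-child (right v) =
  step (inj₁ (subst₂ Child (sym (decode-encode h′ _)) (sym (decode-encode h′ _))
    (f-child root-right)))
       (descent (f ∘ right) (f-child ∘ right) v)

-- The descent is a walk of length `depth`, so the distance `h` is at most the depth, which never
-- exceeds `h`.
leaf-depth : ∀ h ℓ → IsLeaf h ℓ → depth (decode h ℓ) ≡ h
leaf-depth h ℓ (_ , shortest) = ≤-antisym (depth≤h (decode h ℓ))
  (shortest (subst (λ i → Walk (T h) (rootOf h) i (depth (decode h ℓ))) (encode-decode h ℓ)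
    (descent (λ v → v) (λ c → c) (decode h ℓ))))

-- Deletion of a vertex as a barred vertex

module _ (h : ℕ) (ℓ : Fin (order h)) where

  other : Fin (order h) → Bool
  other i = not (does (i ≟ ℓ))

  other-ℓ : other ℓ ≡ false
  other-ℓ = cong not (dec-true (ℓ ≟ ℓ) refl)

  other-≢ : ∀ {i} → i ≢ ℓ → other i ≡ true
  other-≢ {i} i≢ℓ = cong not (dec-false (i ≟ ℓ) i≢ℓ)

  missing-other : Missing (other ∘ encode h) (decode h ℓ)
  missing-other = trans (cong other (encode-decode h ℓ)) other-ℓ ,
    λ v v≢ → other-≢ {encode h v} λ { refl → v≢ (sym (decode-encode h v)) }

  avoids-ℓ : ∀ D → lookup D ℓ ≡ inside → dominates h (other ∘ encode h) false D ≡ false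
  avoids-ℓ D ℓ∈D with dominates h (other ∘ encode h) false D in eq
  ... | false = refl
  ... | true  = ⊥-elim (subst True other-ℓ
    (proj₁ (present-dominated⁻ {h} {other} {D} (subst True (sym eq) tt)) ℓ (lookup⇒[]= ℓ D ℓ∈D)))

  ∈-insertAt⁺ : ∀ {i} {D : Subset (edges h)} → i ∈ D → punchIn ℓ i ∈ insertAt D ℓ outside
  ∈-insertAt⁺ {i} {D} i∈D = lookup⇒[]= _ _ (trans (insertAt-punchIn D ℓ outside i) ([]=⇒lookup i∈D))

  ∈-insertAt⁻ : ∀ {i} {D : Subset (edges h)} → punchIn ℓ i ∈ insertAt D ℓ outside → i ∈ D
  ∈-insertAt⁻ {i} {D} i∈ =
    lookup⇒[]= _ _ (trans (sym (insertAt-punchIn D ℓ outside i)) ([]=⇒lookup i∈))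

  ∉-insertAt : ∀ {D : Subset (edges h)} → ¬ ℓ ∈ insertAt D ℓ outside
  ∉-insertAt {D} ℓ∈ = case trans (sym (insertAt-lookup D ℓ outside)) ([]=⇒lookup ℓ∈) of λ ()

  -- Matching on this view puts vertices in the form `punchIn ℓ i`, where adjacency in `T h` and in
  -- `delete (T h) ℓ` agree by definition.
  data View : Fin (order h) → Set where
    here  : View ℓ
    there : ∀ i → View (punchIn ℓ i)

  view : ∀ i → View i
  view i with ℓ ≟ i
  ... | yes refl = here
  ... | no ℓ≢i   = subst View (punchIn-punchOut ℓ≢i) (there (punchOut ℓ≢i))

  dominating-delete⁺ : ∀ {D} → Dominating (delete (T h) ℓ) D →
    True (dominates h (other ∘ encode h) false (insertAt D ℓ outside))
  dominating-delete⁺ {D} dom = present-dominated⁺ {h} {other} in? cov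
    where
    in? : ∀ i → i ∈ insertAt D ℓ outside → True (other i)
    in? i i∈ = Equivalence.from T-≡ (other-≢ {i} λ { refl → ∉-insertAt i∈ })
    cov : ∀ i → True (other i) → Dominated (T h) (insertAt D ℓ outside) i
    cov i t with view i
    ... | here = ⊥-elim (subst True other-ℓ t)
    ... | there i with dom i
    ...   | inj₁ i∈ = inj₁ (∈-insertAt⁺ i∈)
    ...   | inj₂ (j , adj , j∈) = inj₂ (punchIn ℓ j , adj , ∈-insertAt⁺ j∈)

  dominating-delete⁻ : ∀ {D} → True (dominates h (other ∘ encode h) false (insertAt D ℓ outside)) →
    Dominating (delete (T h) ℓ) D
  dominating-delete⁻ {D} t i
    with proj₂ (present-dominated⁻ {h} {other} t) (punchIn ℓ i)
           (Equivalence.from T-≡ (other-≢ (punchInᵢ≢i ℓ i)))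
  ... | inj₁ i∈ = inj₁ (∈-insertAt⁻ i∈)
  ... | inj₂ (j , adj , j∈) with view j
  ...   | here    = ⊥-elim (∉-insertAt j∈)
  ...   | there j = inj₂ (j , adj , ∈-insertAt⁻ j∈)

corollary12 : (h : ℕ) → 2 ≤ h → (ℓ : Fin (order h)) → IsLeaf h ℓ →
    γ (delete (T h) ℓ) ≡ γ (T h) × ζ (delete (T h) ℓ) ≡ 2 * ζ (T h)
corollary12 h 2≤h ℓ leaf with leading-doubles (regular 2≤h)
... | a , m , 0<m , whole , pruned =
  trans (proj₁ γζ-delete) (sym (proj₁ γζ)) ,
  trans (proj₂ γζ-delete) (cong (2 *_) (sym (proj₂ γζ)))
  where
  γζ : γ (T h) ≡ a × ζ (T h) ≡ m
  γζ = leading-dominating (T h)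
    (λ dom → present-dominated⁺ {h} {λ _ → true} (λ _ _ → tt) (λ i _ → dom i))
    (λ t i → proj₂ (present-dominated⁻ {h} {λ _ → true} t) i tt)
    (whole (λ _ → true) (λ _ → refl)) 0<m
  γζ-delete : γ (delete (T h) ℓ) ≡ a × ζ (delete (T h) ℓ) ≡ 2 * m
  γζ-delete = leading-dominating (delete (T h) ℓ)
    (dominating-delete⁺ h ℓ) (dominating-delete⁻ h ℓ)
    -- The recursion runs on subsets of the whole tree that avoid `ℓ`; these correspond to the
    -- subsets of the smaller vertex set.
    (leading-insertAt ℓ (avoids-ℓ h ℓ)
      (pruned (other h ℓ ∘ encode h) (decode h ℓ) (leaf-depth h ℓ leaf) (missing-other h ℓ)))
    (≤-trans 0<m (m≤m+n m (m + 0)))
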